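{- For every integer $n\ge 1$, $$\mathrm{pf}_n(231,312,321)=\sum_{k=0}^{\lfloor n/2\rfloor}\frac{1}{n+1}\binom{2n-k}{n+k}\binom{n+k}{k}.$$
   Context: A Dyck path of semilength $n$ is a lattice path from $(0,0)$ to $(n,n)$ consisting of $n$ north steps $N=(0,1)$ and $n$ east steps $E=(1,0)$ that never goes below the line $y=x$. A parking function of size $n$ is a Dyck path of semilength $n$ whose $n$ north steps are labeled bijectively by $\{1,\dots,n\}$ so that whenever two north steps are consecutive in the path (one immediately following the other), the label of the later one is larger. For a parking function $p$ of size $n$, $\phi(p)$ is the permutation of $\{1,\dots,n\}$ (in one-line notation) obtained by reading the labels of the north steps in the order they occur along the path. A permutation $\pi$ of $\{1,\dots,n\}$ contains a permutation $\rho$ of $\{1,\dots,m\}$ if there are indices $1\le i_1<\cdots<i_m\le n$ such that $\pi_{i_a}\le\pi_{i_b}$ if and only if $\rho_a\le\rho_b$; otherwise $\pi$ avoids $\rho$. For permutations $\rho_1,\dots,\rho_r$, $\mathrm{pf}_n(\rho_1,\dots,\rho_r)$ denotes the number of parking functions $p$ of size $n$ such that $\phi(p)$ avoids each of $\rho_1,\dots,\rho_r$. -}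

module Defs where

open import Data.Fin.Base as Fin using (Fin)
import Data.Fin.Properties as Fin
open import Data.List.Base
  using (List; []; _∷_; length; lookup; map; mapMaybe; filter; foldr; inits; upTo; cartesianProductWith)
open import Data.List.Membership.Propositional using (_∈_)
open import Data.List.Membership.Propositional.Properties
  using (∈-cartesianProductWith⁺; ∈-filter⁺; ∈-filter⁻; ∈-map⁺; ∈-upTo⁺)
open import Data.List.Properties using (∷-injective)
open import Data.List.Relation.Unary.All using (All; []; _∷_; all?)
open import Data.List.Relation.Unary.AllPairs using ([]; _∷_)
open import Data.List.Relation.Unary.Any using (here; there)
open import Data.List.Relation.Unary.Linked using (Linked; linked?)
open import Data.List.Relation.Unary.Unique.DecPropositional using (unique?)
open import Data.List.Relation.Unary.Unique.Propositional using (Unique)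
import Data.List.Relation.Unary.Unique.Propositional.Properties as Unique
open import Data.Maybe.Base using (Maybe; just; nothing)
open import Data.Nat.Base using (ℕ; zero; suc; _+_; _*_; _≤_; _<_)
open import Data.Nat.Properties
  using (_≟_; _≤?_; _<?_; +-suc; +-identityʳ)
open import Data.Product.Base using (∃-syntax; _×_; _,_; proj₂)
open import Data.Rational.Base as ℚ using (ℚ; 0ℚ)
open import Data.Unit.Base using (⊤; tt)
open import Data.Vec.Base as Vec using (Vec)
open import Function.Base using (_∘_)
open import Function.Bundles using (_⇔_; mk⇔; Equivalence)
open import Relation.Binary.Definitions using (Decidable; DecidableEquality)
open import Relation.Binary.PropositionalEquality
  using (_≡_; refl; sym; trans; cong; cong₂)
open import Relation.Nullary.Decidable using (Dec; yes; no; map′; _×-dec_; _→-dec_; ¬?)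
open import Relation.Nullary.Negation using (¬_)
import Relation.Unary as U

data Step : Set where
  N E : Step

_≟ˢ_ : DecidableEquality Step
N ≟ˢ N = yes refl
N ≟ˢ E = no λ ()
E ≟ˢ N = no λ ()
E ≟ˢ E = yes refl

#N #E : List Step → ℕ
#N = length ∘ filter (_≟ˢ N)
#E = length ∘ filter (_≟ˢ E)

-- The prefix q of a path ends at the lattice point (#E q , #N q).
WeaklyAboveDiagonal : List Step → Set
WeaklyAboveDiagonal p = All (λ q → #E q ≤ #N q) (inits p)

IsDyckPath : ℕ → List Step → Set
IsDyckPath n p = #N p ≡ n × #E p ≡ n × WeaklyAboveDiagonal p

isDyckPath? : ∀ n → U.Decidable (IsDyckPath n)
isDyckPath? n p =
  #N p ≟ n ×-dec #E p ≟ n ×-dec all? (λ q → #E q ≤? #N q) (inits p)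

-- One-line notation of a permutation of {1,…,n}.
IsPermutation : ℕ → List ℕ → Set
IsPermutation n π = length π ≡ n × All (λ ℓ → 1 ≤ ℓ × ℓ ≤ n) π × Unique π

isPermutation? : ∀ n → U.Decidable (IsPermutation n)
isPermutation? n π =
  length π ≟ n ×-dec all? (λ ℓ → 1 ≤? ℓ ×-dec ℓ ≤? n) π ×-dec unique? _≟_ π

-- The vector i lists the positions i₁ < ⋯ < iₘ of an occurrence of ρ in π.
IsOccurrence : (π ρ : List ℕ) → Vec (Fin (length π)) (length ρ) → Set
IsOccurrence π ρ i =
  (∀ a b → a Fin.< b → Vec.lookup i a Fin.< Vec.lookup i b) ×
  (∀ a b → lookup π (Vec.lookup i a) ≤ lookup π (Vec.lookup i b)
             ⇔ lookup ρ a ≤ lookup ρ b)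

_Contains_ : List ℕ → List ℕ → Set
π Contains ρ = ∃[ i ] IsOccurrence π ρ i

_Avoids_ : List ℕ → List ℕ → Set
π Avoids ρ = ¬ (π Contains ρ)

_⇔-dec_ : {A B : Set} → Dec A → Dec B → Dec (A ⇔ B)
a? ⇔-dec b? =
  map′ (λ (f , g) → mk⇔ f g) (λ e → Equivalence.to e , Equivalence.from e)
    ((a? →-dec b?) ×-dec (b? →-dec a?))

anyVec? : ∀ {m k} {P : Vec (Fin m) k → Set} → U.Decidable P → Dec (∃[ v ] P v)
anyVec? {k = zero} P? =
  map′ (Vec.[] ,_) (λ { (Vec.[] , p) → p }) (P? Vec.[])
anyVec? {k = suc k} P? =
  map′ (λ (x , v , p) → (x Vec.∷ v) , p) (λ { (x Vec.∷ v , p) → x , v , p })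
    (Fin.any? λ x → anyVec? λ v → P? (x Vec.∷ v))

isOccurrence? : ∀ π ρ → U.Decidable (IsOccurrence π ρ)
isOccurrence? π ρ i =
  Fin.all? (λ a → Fin.all? λ b →
    (a Fin.<? b) →-dec (Vec.lookup i a Fin.<? Vec.lookup i b)) ×-dec
  Fin.all? (λ a → Fin.all? λ b →
    (lookup π (Vec.lookup i a) ≤? lookup π (Vec.lookup i b))
      ⇔-dec (lookup ρ a ≤? lookup ρ b))

_avoids?_ : Decidable _Avoids_
π avoids? ρ = ¬? (anyVec? (isOccurrence? π ρ))

AvoidsAll : List (List ℕ) → List ℕ → Set
AvoidsAll ρs π = All (π Avoids_) ρs

avoidsAll? : ∀ ρs → U.Decidable (AvoidsAll ρs)
avoidsAll? ρs π = all? (π avoids?_) ρs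

data LabelledStep : Set where
  north : ℕ → LabelledStep
  east  : LabelledStep

forget : LabelledStep → Step
forget (north _) = N
forget east      = E

label : LabelledStep → Maybe ℕ
label (north ℓ) = just ℓ
label east      = nothing

path : List LabelledStep → List Step
path = map forget

-- φ p reads the labels of the north steps in the order they occur along p.
φ : List LabelledStep → List ℕ
φ = mapMaybe label

IncreasingNorths : LabelledStep → LabelledStep → Set
IncreasingNorths (north k) (north ℓ) = k < ℓ
IncreasingNorths _         _         = ⊤

increasingNorths? : Decidable IncreasingNorths
increasingNorths? (north k) (north ℓ) = k <? ℓ
increasingNorths? (north _) east      = yes tt
increasingNorths? east      _         = yes tt

IsParkingFunction : ℕ → List LabelledStep → Set
IsParkingFunction n p =
  IsDyckPath n (path p) × IsPermutation n (φ p) × Linked IncreasingNorths p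

isParkingFunction? : ∀ n → U.Decidable (IsParkingFunction n)
isParkingFunction? n p =
  isDyckPath? n (path p) ×-dec isPermutation? n (φ p) ×-dec linked? increasingNorths? p

words : {A : Set} → List A → ℕ → List (List A)
words as zero    = [] ∷ []
words as (suc k) = cartesianProductWith _∷_ as (words as k)

labelledSteps : ℕ → List LabelledStep
labelledSteps n = east ∷ map (north ∘ suc) (upTo n)

parkingFunctions : ℕ → List (List LabelledStep)
parkingFunctions n = filter (isParkingFunction? n) (words (labelledSteps n) (2 * n))

pf : ℕ → List (List ℕ) → ℕ
pf n ρs = length (filter (avoidsAll? ρs ∘ φ) (parkingFunctions n))

-- The lemmas below culminate in parkingFunctions-unique and ∈-parkingFunctions:
-- parkingFunctions n lists every parking function of size n exactly once, so
-- that pf is the intended count.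

words-unique : {A : Set} {as : List A} → Unique as → ∀ k → Unique (words as k)
words-unique as! zero    = [] ∷ []
words-unique as! (suc k) =
  Unique.cartesianProductWith⁺ _∷_ ∷-injective as! (words-unique as! k)

∈-words : {A : Set} {as w : List A} → All (_∈ as) w → w ∈ words as (length w)
∈-words []         = here refl
∈-words (a∈ ∷ as∈) = ∈-cartesianProductWith⁺ _∷_ a∈ (∈-words as∈)

labelledSteps-unique : ∀ n → Unique (labelledSteps n)
labelledSteps-unique n = east∉ (upTo n) ∷ Unique.map⁺ (λ { refl → refl }) (Unique.upTo⁺ n)
  where
  east∉ : ∀ ks → All (λ s → ¬ east ≡ s) (map (north ∘ suc) ks)
  east∉ []       = []
  east∉ (_ ∷ ks) = (λ ()) ∷ east∉ ks

∈-labelledSteps : ∀ {n} p → All (λ ℓ → 1 ≤ ℓ × ℓ ≤ n) (φ p) → All (_∈ labelledSteps n) p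
∈-labelledSteps []            _                     = []
∈-labelledSteps (east ∷ p)    ℓs                    = here refl ∷ ∈-labelledSteps p ℓs
∈-labelledSteps (north (suc ℓ) ∷ p) ((_ , ℓ<n) ∷ ℓs) =
  there (∈-map⁺ (north ∘ suc) (∈-upTo⁺ ℓ<n)) ∷ ∈-labelledSteps p ℓs

length-path : ∀ p → length p ≡ #N (path p) + #E (path p)
length-path []            = refl
length-path (north _ ∷ p) = cong suc (length-path p)
length-path (east ∷ p)    = trans (cong suc (length-path p)) (sym (+-suc _ _))

parkingFunctions-unique : ∀ n → Unique (parkingFunctions n)
parkingFunctions-unique n =
  Unique.filter⁺ (isParkingFunction? n) (words-unique (labelledSteps-unique n) (2 * n))

∈-parkingFunctions : ∀ n p → p ∈ parkingFunctions n ⇔ IsParkingFunction n p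
∈-parkingFunctions n p = mk⇔
  (λ p∈ → proj₂ (∈-filter⁻ (isParkingFunction? n) {xs = words (labelledSteps n) (2 * n)} p∈))
  (λ p! → ∈-filter⁺ (isParkingFunction? n) (candidate p!) p!)
  where
  candidate : IsParkingFunction n p → p ∈ words (labelledSteps n) (2 * n)
  candidate ((#N≡n , #E≡n , _) , (_ , ℓs , _) , _)
    rewrite +-identityʳ n | sym (trans (length-path p) (cong₂ _+_ #N≡n #E≡n)) =
    ∈-words (∈-labelledSteps p ℓs)

∑[0⋯_] : ℕ → (ℕ → ℚ) → ℚ
∑[0⋯ m ] f = foldr ℚ._+_ 0ℚ (map f (upTo (suc m)))

{-# OPTIONS --safe #-}
module Submission where

-- A permutation avoids 231, 312 and 321 iff it has no inversion of values that
-- differ by at least 2, i.e. iff it is a direct sum of blocks 1 and 21.  A parking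
-- function over such a permutation is built by appending steps: an east step,
-- a single label m+1, or a block "north (m+2), at least one east, north (m+1)".
-- Let T = 1 + x T² + x² T³ and μ = x T + x² T², so that T = 1 + T μ.  With x marking
-- north steps, the prefixes ending at height h have generating function T μʰ, and
-- those whose current block 21 still awaits its second north, after at least one
-- east, have x T² μʰ (that second north not counted): both families satisfy the
-- recurrences given by the last step.  In particular parking functions are counted
-- by T, and sorting the monomials of T by the number k of uses of x² T³ gives the summands.

open import Defs
open import Data.Empty using (⊥)
open import Data.Fin.Base as Fin using (Fin; zero; suc)
import Data.Fin.Properties as Fin
open import Data.Integer.Base using (+_)
import Data.Integer.Base as ℤ using (_*_; _+_)
import Data.Integer.Properties as ℤ
open import Data.List.Base
  using (List; []; _∷_; _++_; _ʳ++_; length; lookup; map; inits; upTo; filter; reverse; foldr; applyUpTo)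
open import Data.List.Membership.DecPropositional using (_∈?_)
open import Data.List.Membership.Propositional using (_∈_)
open import Data.List.Membership.Propositional.Properties
  using (∈-lookup; ∈-∃++; ∈-++⁻; ∈-++⁺ˡ; ∈-++⁺ʳ; ∈-map⁺; ∈-map⁻; ∈-upTo⁺; ∈-filter⁺; ∈-filter⁻)
open import Data.List.Properties
  using (length-map; length-++; length-upTo; map-upTo; tabulate-lookup; ∷-injective; ∷-injectiveʳ;
         reverse-injective; reverse-involutive)
open import Data.List.Relation.Binary.Disjoint.Propositional using (Disjoint)
open import Data.List.Relation.Unary.All as All using (All; []; _∷_)
import Data.List.Relation.Unary.All.Properties as All
open import Data.List.Relation.Unary.AllPairs using (AllPairs; []; _∷_)
import Data.List.Relation.Unary.AllPairs.Properties as AllPairs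
open import Data.List.Relation.Unary.Any as Any using (here; there)
open import Data.List.Relation.Unary.Any.Properties using (lookup-index)
open import Data.List.Relation.Unary.Linked as Linked using (Linked; []; [-]; _∷_)
open import Data.List.Relation.Unary.Unique.Propositional using (Unique)
import Data.List.Relation.Unary.Unique.Propositional.Properties as Unique
import Data.Nat.Base as Nat
open import Data.Nat.Base
  using (ℕ; zero; suc; _+_; _*_; _∸_; _≤_; _<_; _≥_; z≤n; s≤s; z<s; _!; ⌊_/2⌋)
open import Data.Nat.Combinatorics using (_C_; nCk≡n!/k![n-k]!; k![n∸k]!∣n!)
open import Data.Nat.DivMod using (m/n*n≡m)
open import Data.Nat.Properties
open import Data.Nat.Tactic.RingSolver using (solve-∀)
open import Data.Product.Base using (∃-syntax; _×_; _,_; proj₁; proj₂)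
open import Data.Rational.Base as ℚ using (ℚ; 0ℚ; _/_; fromℚᵘ; toℚᵘ)
open import Data.Rational.Properties using (toℚᵘ-injective; toℚᵘ-fromℚᵘ; fromℚᵘ-cong; toℚᵘ-homo-+; toℚᵘ-homo-*)
import Data.Rational.Properties as ℚ
open import Data.Rational.Unnormalised.Base as ℚᵘ using (mkℚᵘ; *≡*)
import Data.Rational.Unnormalised.Properties as ℚᵘ
open import Data.Sum.Base using (_⊎_; inj₁; inj₂)
open import Data.Unit.Base using (tt)
open import Data.Vec.Base as Vec using ([]; _∷_)
open import Function.Base using (_∘_)
open import Function.Bundles using (mk⇔; Equivalence)
open import Relation.Binary.Definitions using (Tri; tri<; tri≈; tri>)
open import Relation.Binary.PropositionalEquality
  using (_≡_; _≢_; refl; sym; trans; cong; cong₂; subst; subst₂; module ≡-Reasoning)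
open import Relation.Nullary.Decidable using (yes; no)
open import Relation.Nullary.Negation using (¬_; contradiction)
import Relation.Unary as U

private variable
  n m h : ℕ

-- Coefficients

-- coeff n p = [xⁿ] Tᵖ
coeff : ℕ → ℕ → ℕ
coeff zero          p       = 1
coeff (suc n)       zero    = 0
coeff (suc zero)    (suc p) = coeff 1 p + coeff 0 (2 + p)
coeff (suc (suc n)) (suc p) = coeff (suc (suc n)) p + (coeff (suc n) (2 + p) + coeff n (3 + p))

-- coeffμ e p h = [xᵉ⁺ʰ] Tᵖ μʰ, h being the order of μʰ
coeffμ : ℕ → ℕ → ℕ → ℕ
coeffμ e       p zero    = coeff e p
coeffμ zero    p (suc h) = coeffμ 0 (suc p) h
coeffμ (suc e) p (suc h) = coeffμ (suc e) (suc p) h + coeffμ e (2 + p) h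

-- `T` and μ/x both have constant term 1, so the lowest coefficient is the same for every power of
-- `T`.
coeffμ-zero : ∀ p h → coeffμ 0 (suc p) h ≡ coeffμ 0 p h
coeffμ-zero p zero    = refl
coeffμ-zero p (suc h) = coeffμ-zero (suc p) h

+-interchange : ∀ a b c d → (a + b) + (c + d) ≡ (a + c) + (b + d)
+-interchange = solve-∀

-- Tᵖ⁺¹ μʰ = Tᵖ μʰ + Tᵖ⁺¹ μʰ⁺¹
coeffμ-step : ∀ e p h → coeffμ (suc e) (suc p) h ≡ coeffμ (suc e) p h + coeffμ e (suc p) (suc h)
coeffμ-step zero    p zero    = refl
coeffμ-step (suc e) p zero    = refl
-- One factor μ = x T + x² T² is unfolded. For `e` = 0 its second part meets only lowest
-- coefficients, where `coeffμ-zero` takes the place of the induction hypothesis.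
coeffμ-step zero    p (suc h) = begin
  coeffμ 1 (2 + p) h + coeffμ 0 (3 + p) h
    ≡⟨ cong₂ _+_ (coeffμ-step 0 (suc p) h) (coeffμ-zero (2 + p) h) ⟩
  (coeffμ 1 (1 + p) h + coeffμ 0 (2 + p) (suc h)) + coeffμ 0 (2 + p) h
    ≡⟨ swap (coeffμ 1 (1 + p) h) (coeffμ 0 (2 + p) (suc h)) _ ⟩
  (coeffμ 1 (1 + p) h + coeffμ 0 (2 + p) h) + coeffμ 0 (2 + p) (suc h) ∎
  where
  open ≡-Reasoning
  swap : ∀ a b c → (a + b) + c ≡ (a + c) + b
  swap = solve-∀
coeffμ-step (suc e) p (suc h) = trans
  (cong₂ _+_ (coeffμ-step (suc e) (suc p) h) (coeffμ-step e (2 + p) h))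
  (+-interchange (coeffμ (2 + e) (1 + p) h) _ _ _)

-- T counts plane trees with binary nodes (weight x) and ternary nodes (weight x²);
-- τ p b k counts forests of p trees with b binary and k ternary nodes, and
-- τ₂, τ₃ come from the terms x Tᵖ⁺² and x² Tᵖ⁺³ of Tᵖ⁺¹.
τ τ₂ τ₃ : ℕ → ℕ → ℕ → ℕ
τ (suc p) b       k       = τ p b k + (τ₂ p b k + τ₃ p b k)
τ zero    zero    zero    = 1
τ zero    zero    (suc k) = 0
τ zero    (suc b) k       = 0
τ₂ p zero    k = 0
τ₂ p (suc b) k = τ (2 + p) b k
τ₃ p b zero    = 0
τ₃ p b (suc k) = τ (3 + p) b k

τ-origin : ∀ p → τ p 0 0 ≡ 1
τ-origin zero    = refl
τ-origin (suc p) = trans (+-identityʳ _) (τ-origin p)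

-- Σ₂ n g is the sum of g b k over b + 2 k = n.
Σ₂ : ℕ → (ℕ → ℕ → ℕ) → ℕ
Σ₂ zero          g = g 0 0
Σ₂ (suc zero)    g = g 1 0
Σ₂ (suc (suc n)) g = g (2 + n) 0 + Σ₂ n (λ b k → g b (suc k))

Σ₂-+ : ∀ n f g → Σ₂ n (λ b k → f b k + g b k) ≡ Σ₂ n f + Σ₂ n g
Σ₂-+ zero          f g = refl
Σ₂-+ (suc zero)    f g = refl
Σ₂-+ (suc (suc n)) f g = trans
  (cong (λ s → (f (2 + n) 0 + g (2 + n) 0) + s) (Σ₂-+ n (λ b k → f b (suc k)) (λ b k → g b (suc k))))
  (+-interchange (f (2 + n) 0) _ _ _)

Σ₂-zero : ∀ n {g} → (∀ b k → g b k ≡ 0) → Σ₂ n g ≡ 0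
Σ₂-zero zero          g≡0 = g≡0 0 0
Σ₂-zero (suc zero)    g≡0 = g≡0 1 0
Σ₂-zero (suc (suc n)) g≡0 = cong₂ _+_ (g≡0 (2 + n) 0) (Σ₂-zero n λ b k → g≡0 b (suc k))

-- This is multiplication by x: the pairs missed by b ↦ b + 1 have b = 0, where `g` vanishes.
Σ₂-shift : ∀ n {g} → (∀ k → g 0 k ≡ 0) → Σ₂ (suc n) g ≡ Σ₂ n (λ b → g (suc b))
Σ₂-shift zero              g₀≡0 = refl
Σ₂-shift (suc zero)    {g} g₀≡0 = trans (cong (λ s → g 2 0 + s) (g₀≡0 1)) (+-identityʳ _)
Σ₂-shift (suc (suc n)) {g} g₀≡0 = cong (λ s → g (3 + n) 0 + s) (Σ₂-shift n λ k → g₀≡0 (suc k))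

-- Both sides obey Tᵖ⁺¹ = Tᵖ + x Tᵖ⁺² + x² Tᵖ⁺³.
coeff≡Σ₂τ : ∀ n p → coeff n p ≡ Σ₂ n (τ p)
coeff≡Σ₂τ zero          p       = sym (τ-origin p)
coeff≡Σ₂τ (suc zero)    zero    = refl
coeff≡Σ₂τ (suc (suc n)) zero    = sym (Σ₂-zero n λ { zero _ → refl ; (suc _) _ → refl })
coeff≡Σ₂τ (suc zero)    (suc p) =
  cong₂ _+_ (coeff≡Σ₂τ 1 p) (trans (coeff≡Σ₂τ 0 (2 + p)) (sym (+-identityʳ _)))
coeff≡Σ₂τ (suc (suc n)) (suc p) = begin
  coeff (2 + n) p + (coeff (1 + n) (2 + p) + coeff n (3 + p))
    ≡⟨ cong₂ _+_ (coeff≡Σ₂τ (suc (suc n)) p) (cong₂ _+_ (coeff≡Σ₂τ (suc n) (2 + p)) (coeff≡Σ₂τ n (3 + p))) ⟩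
  Σ₂ (2 + n) (τ p) + (Σ₂ (1 + n) (τ (2 + p)) + Σ₂ n (τ (3 + p)))
    -- Only the shift by x needs a lemma; `Σ₂ (2 + n) (τ₃ p)` computes to `Σ₂ n (τ (3 + p))`, its k
    -- = 0 term being zero.
    ≡⟨ cong (λ s → Σ₂ (2 + n) (τ p) + (s + Σ₂ n (τ (3 + p)))) (Σ₂-shift (1 + n) {τ₂ p} λ _ → refl) ⟨
  Σ₂ (2 + n) (τ p) + (Σ₂ (2 + n) (τ₂ p) + Σ₂ (2 + n) (τ₃ p))
    ≡⟨ cong (λ s → Σ₂ (2 + n) (τ p) + s) (Σ₂-+ (2 + n) (τ₂ p) (τ₃ p)) ⟨
  Σ₂ (2 + n) (τ p) + Σ₂ (2 + n) (λ b k → τ₂ p b k + τ₃ p b k)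
    ≡⟨ Σ₂-+ (2 + n) (τ p) (λ b k → τ₂ p b k + τ₃ p b k) ⟨
  Σ₂ (2 + n) (τ (suc p)) ∎
  where open ≡-Reasoning

τ-step : ∀ p b k a {m x y z} B K F → a ≡ b + 2 * k + p → m ≡ b + k + a →
         x * (a ! * B * K) ≡ p * F →
         y * ((suc a) ! * B * K) ≡ b * ((2 + p) * F) →
         z * ((suc a) ! * B * K) ≡ k * ((3 + p) * F) →
         (x + (y + z)) * ((suc a) ! * B * K) ≡ suc p * (m * F)
τ-step p b k a {x = x} {y} {z} B K F refl refl X Y Z = begin
  (x + (y + z)) * (suc a * a ! * B * K)
    ≡⟨ expand x y z (suc a) (a !) B K ⟩
  suc a * (x * (a ! * B * K)) + (y * (suc a * a ! * B * K) + z * (suc a * a ! * B * K))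
    ≡⟨ cong₂ _+_ (cong (suc a *_) X) (cong₂ _+_ Y Z) ⟩
  suc a * (p * F) + (b * ((2 + p) * F) + k * ((3 + p) * F))
    ≡⟨ collect p b k F ⟩
  suc p * ((b + k + a) * F) ∎
  where
  open ≡-Reasoning
  expand : ∀ x y z s A B K → (x + (y + z)) * (s * A * B * K) ≡
           s * (x * (A * B * K)) + (y * (s * A * B * K) + z * (s * A * B * K))
  expand = solve-∀
  collect : ∀ p b k F →
    suc (b + 2 * k + p) * (p * F) + (b * ((2 + p) * F) + k * ((3 + p) * F)) ≡
    suc p * ((b + k + (b + 2 * k + p)) * F)
  collect = solve-∀

-- The ballot formula τ p b k = p (a+b+k−1)! / (a! b! k!), with a leaves.  In the
-- inductive step clearing the factorials turns the recursion of τ into τ-step.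
τ-closed : ∀ p b k a m → a ≡ b + 2 * k + p → suc m ≡ b + k + a →
           τ p b k * (a ! * b ! * k !) ≡ p * m !
τ-closed zero    zero    zero    _ _ refl ()
τ-closed zero    zero    (suc k) _ _ _    _    = refl
τ-closed zero    (suc b) k       _ _ _    _    = refl
τ-closed (suc p) zero    zero    _ _ refl refl =
  trans (cong (_* (suc p ! * 1 * 1)) (τ-origin (suc p))) (units (suc p) (p !))
  where
  units : ∀ q P → 1 * (q * P * 1 * 1) ≡ q * P
  units = solve-∀
τ-closed (suc p) b@zero (suc k) (suc a) zero _ mₑ = contradiction (sym (suc-injective mₑ)) (m+1+n≢0 k)
τ-closed (suc p) (suc b) k (suc a) zero _ mₑ = contradiction (sym (suc-injective mₑ)) (m+1+n≢0 (b + k))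
τ-closed (suc p) (suc b) k zero _ () _
τ-closed (suc p) zero (suc k) zero _ () _
τ-closed (suc p) b k (suc a) (suc m) aₑ mₑ =
  τ-step p b k a {x = τ p b k} {τ₂ p b k} {τ₃ p b k} (b !) (k !) (m !) a≡ m≡
    (τ-closed p b k a m a≡ m≡) (lower₂ b k aₑ mₑ) (lower₃ b k aₑ mₑ)
  where
  a≡ : a ≡ b + 2 * k + p
  a≡ = suc-injective (trans aₑ (+-suc _ p))
  m≡ : suc m ≡ b + k + a
  m≡ = suc-injective (trans mₑ (+-suc _ a))
  -- Deleting a binary root turns one tree into two and keeps all a + 1 leaves; the factor `b` is
  -- b!/(b-1)!. A ternary root, in `lower₃`, leaves three trees and gives the factor `k`.
  lower₂ : ∀ b k → suc a ≡ b + 2 * k + suc p → 2 + m ≡ b + k + suc a →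
           τ₂ p b k * ((suc a) ! * b ! * k !) ≡ b * ((2 + p) * m !)
  lower₂ zero    k aₑ mₑ = refl
  lower₂ (suc b) k aₑ mₑ = trans (scale (τ (2 + p) b k) (suc a !) (suc b) (b !) (k !))
    (cong (suc b *_) (τ-closed (2 + p) b k (suc a) m (trans aₑ (sides b k p)) (suc-injective mₑ)))
    where
    scale : ∀ t A s B K → t * (A * (s * B) * K) ≡ s * (t * (A * B * K))
    scale = solve-∀
    sides : ∀ b k p → suc b + 2 * k + suc p ≡ b + 2 * k + (2 + p)
    sides = solve-∀
  lower₃ : ∀ b k → suc a ≡ b + 2 * k + suc p → 2 + m ≡ b + k + suc a →
           τ₃ p b k * ((suc a) ! * b ! * k !) ≡ k * ((3 + p) * m !)
  lower₃ b zero    aₑ mₑ = refl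
  lower₃ b (suc k) aₑ mₑ = trans (scale (τ (3 + p) b k) (suc a !) (b !) (suc k) (k !))
    (cong (suc k *_) (τ-closed (3 + p) b k (suc a) m (trans aₑ (sides b k p))
      (suc-injective (trans mₑ (cong (_+ suc a) (+-suc b k))))))
    where
    scale : ∀ t A B s K → t * (A * B * (s * K)) ≡ s * (t * (A * B * K))
    scale = solve-∀
    sides : ∀ b k p → b + 2 * suc k + suc p ≡ b + 2 * k + (3 + p)
    sides = solve-∀

-- Ballot numbers as products of binomial coefficients

C-factorial : ∀ i j → ((i + j) C i) * (i ! * j !) ≡ (i + j) !
C-factorial i j = begin
  ((i + j) C i) * (i ! * j !)
    ≡⟨ cong (λ d → ((i + j) C i) * (i ! * d !)) (m+n∸m≡n i j) ⟨
  ((i + j) C i) * (i ! * (i + j ∸ i) !)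
    ≡⟨ cong (_* (i ! * (i + j ∸ i) !)) (nCk≡n!/k![n-k]! (m≤m+n i j)) ⟩
  ((i + j) ! Nat./ (i ! * (i + j ∸ i) !)) * (i ! * (i + j ∸ i) !)
    ≡⟨ m/n*n≡m (k![n∸k]!∣n! (m≤m+n i j)) ⟩
  (i + j) ! ∎
  where
  open ≡-Reasoning
  instance _ = i !* (i + j ∸ i) !≢0

-- Here 2n - k = (n+k) + b, so the binomials are (n+k+b)!/((n+k)! b!) and (n+k)!/(k! n!). A single
-- tree has n + 1 leaves, and its ballot number is (n+k+b)!/((n+1)! b! k!).
τ-binomial : ∀ n b k → b + 2 * k ≡ n →
             ((2 * n ∸ k) C (n + k)) * ((n + k) C k) ≡ suc n * τ 1 b k
τ-binomial n b k refl = *-cancelʳ-≡ _ _ ((n + k) ! * (n ! * b ! * k !)) (begin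
  C₁ * C₂ * ((n + k) ! * (n ! * b ! * k !))
    ≡⟨ regroup C₁ C₂ ((n + k) !) (n !) (b !) (k !) ⟩
  (C₁ * ((n + k) ! * b !)) * (C₂ * (k ! * n !))
    ≡⟨ cong₂ _*_ C₁-factorial C₂-factorial ⟩
  (n + k + b) ! * (n + k) !
    ≡⟨ cong (_* (n + k) !) (trans
         (τ-closed 1 b k (suc n) (n + k + b) (+-comm 1 n) (sides b k n)) (*-identityˡ _)) ⟨
  (τ 1 b k * (suc n * n ! * b ! * k !)) * (n + k) !
    ≡⟨ regroup′ (τ 1 b k) (suc n) (n !) (b !) (k !) ((n + k) !) ⟩
  suc n * τ 1 b k * ((n + k) ! * (n ! * b ! * k !)) ∎)
  where
  open ≡-Reasoning
  C₁ = (2 * n ∸ k) C (n + k)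
  C₂ = (n + k) C k
  2n : ∀ b k → 2 * (b + 2 * k) ≡ (b + 2 * k + k + b) + k
  2n = solve-∀
  2n∸k : 2 * n ∸ k ≡ n + k + b
  2n∸k = trans (cong (_∸ k) (2n b k)) (m+n∸n≡m (n + k + b) k)
  C₁-factorial : C₁ * ((n + k) ! * b !) ≡ (n + k + b) !
  C₁-factorial = trans (cong (λ d → (d C (n + k)) * ((n + k) ! * b !)) 2n∸k) (C-factorial (n + k) b)
  C₂-factorial : C₂ * (k ! * n !) ≡ (n + k) !
  C₂-factorial = trans (cong (λ d → (d C k) * (k ! * n !)) (+-comm n k))
    (trans (C-factorial k n) (cong _! (+-comm k n)))
  regroup : ∀ c d P Q B K → c * d * (P * (Q * B * K)) ≡ (c * (P * B)) * (d * (K * Q))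
  regroup = solve-∀
  regroup′ : ∀ t s Q B K P → (t * (s * Q * B * K)) * P ≡ s * t * (P * (Q * B * K))
  regroup′ = solve-∀
  sides : ∀ b k n → suc (n + k + b) ≡ b + k + suc n
  sides = solve-∀
  instance
    _ = n !≢0
    _ = b !≢0
    _ = k !≢0
    _ = (n + k) !≢0
    _ = m*n≢0 (n !) (b !)
    _ = m*n≢0 (n ! * b !) (k !)
    _ = m*n≢0 ((n + k) !) (n ! * b ! * k !)

-- Transfer to rational sums

fromℚᵘ-homo-+ : ∀ p q → fromℚᵘ p ℚ.+ fromℚᵘ q ≡ fromℚᵘ (p ℚᵘ.+ q)
fromℚᵘ-homo-+ p q = toℚᵘ-injective (begin
  toℚᵘ (fromℚᵘ p ℚ.+ fromℚᵘ q)          ≈⟨ toℚᵘ-homo-+ (fromℚᵘ p) (fromℚᵘ q) ⟩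
  toℚᵘ (fromℚᵘ p) ℚᵘ.+ toℚᵘ (fromℚᵘ q)  ≈⟨ ℚᵘ.+-cong (toℚᵘ-fromℚᵘ p) (toℚᵘ-fromℚᵘ q) ⟩
  p ℚᵘ.+ q                              ≈⟨ toℚᵘ-fromℚᵘ (p ℚᵘ.+ q) ⟨
  toℚᵘ (fromℚᵘ (p ℚᵘ.+ q))              ∎)
  where open ℚᵘ.≃-Reasoning

fromℚᵘ-homo-* : ∀ p q → fromℚᵘ p ℚ.* fromℚᵘ q ≡ fromℚᵘ (p ℚᵘ.* q)
fromℚᵘ-homo-* p q = toℚᵘ-injective (begin
  toℚᵘ (fromℚᵘ p ℚ.* fromℚᵘ q)          ≈⟨ toℚᵘ-homo-* (fromℚᵘ p) (fromℚᵘ q) ⟩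
  toℚᵘ (fromℚᵘ p) ℚᵘ.* toℚᵘ (fromℚᵘ q)  ≈⟨ ℚᵘ.*-cong (toℚᵘ-fromℚᵘ p) (toℚᵘ-fromℚᵘ q) ⟩
  p ℚᵘ.* q                              ≈⟨ toℚᵘ-fromℚᵘ (p ℚᵘ.* q) ⟨
  toℚᵘ (fromℚᵘ (p ℚᵘ.* q))              ∎)
  where open ℚᵘ.≃-Reasoning

-- `+ a / 1` is by definition `fromℚᵘ (mkℚᵘ (+ a) 0)`, and equality of unnormalised fractions is
-- cross-multiplication, free of gcds.
+-homo-/1 : ∀ a b → (+ a / 1) ℚ.+ (+ b / 1) ≡ + (a + b) / 1
+-homo-/1 a b = trans (fromℚᵘ-homo-+ (mkℚᵘ (+ a) 0) (mkℚᵘ (+ b) 0))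
  (fromℚᵘ-cong {mkℚᵘ (+ a) 0 ℚᵘ.+ mkℚᵘ (+ b) 0} {mkℚᵘ (+ (a + b)) 0}
    (*≡* (cong (ℤ._* + 1) (cong₂ ℤ._+_ (ℤ.*-identityʳ (+ a)) (ℤ.*-identityʳ (+ b))))))

quotient : ∀ n a b t → a * b ≡ suc n * t → (+ 1 / suc n) ℚ.* (+ a / 1) ℚ.* (+ b / 1) ≡ + t / 1
quotient n a b t ab≡ = begin
  (+ 1 / suc n) ℚ.* (+ a / 1) ℚ.* (+ b / 1)
    ≡⟨ cong (ℚ._* (+ b / 1)) (fromℚᵘ-homo-* (mkℚᵘ (+ 1) n) (mkℚᵘ (+ a) 0)) ⟩
  fromℚᵘ (mkℚᵘ (+ 1) n ℚᵘ.* mkℚᵘ (+ a) 0) ℚ.* (+ b / 1)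
    ≡⟨ fromℚᵘ-homo-* (mkℚᵘ (+ 1) n ℚᵘ.* mkℚᵘ (+ a) 0) (mkℚᵘ (+ b) 0) ⟩
  fromℚᵘ (mkℚᵘ (+ 1) n ℚᵘ.* mkℚᵘ (+ a) 0 ℚᵘ.* mkℚᵘ (+ b) 0)
    ≡⟨ fromℚᵘ-cong {mkℚᵘ (+ 1) n ℚᵘ.* mkℚᵘ (+ a) 0 ℚᵘ.* mkℚᵘ (+ b) 0} {mkℚᵘ (+ t) 0} (*≡* cross) ⟩
  + t / 1 ∎
  where
  open ≡-Reasoning
  -- `suc (n * 1 * 1)` is what the denominator of the unnormalised product computes to.
  units : ∀ n t → suc n * t ≡ t * suc (n * 1 * 1)
  units = solve-∀
  cross : (+ 1 ℤ.* + a) ℤ.* + b ℤ.* + 1 ≡ + t ℤ.* + suc (n * 1 * 1)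
  cross = begin
    (+ 1 ℤ.* + a) ℤ.* + b ℤ.* + 1 ≡⟨ ℤ.*-identityʳ _ ⟩
    (+ 1 ℤ.* + a) ℤ.* + b         ≡⟨ cong (ℤ._* + b) (ℤ.*-identityˡ (+ a)) ⟩
    + a ℤ.* + b                   ≡⟨ ℤ.pos-* a b ⟨
    + (a * b)                     ≡⟨ cong +_ (trans ab≡ (units n t)) ⟩
    + (t * suc (n * 1 * 1))       ≡⟨ ℤ.pos-* t _ ⟩
    + t ℤ.* + suc (n * 1 * 1)     ∎

-- The bound ⌊n/2⌋ keeps exactly the k for which b = n - 2k is a natural number. Splitting off k = 0
-- lowers n by two.
∑-Σ₂ : ∀ n (f : ℕ → ℚ) g → (∀ b k → b + 2 * k ≡ n → f k ≡ + g b k / 1) →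
       ∑[0⋯ ⌊ n /2⌋ ] f ≡ + Σ₂ n g / 1
∑-Σ₂ n f g f≡g = trans (cong (foldr ℚ._+_ 0ℚ) (map-upTo f (suc ⌊ n /2⌋))) (go n f g f≡g)
  where
  go : ∀ n (f : ℕ → ℚ) g → (∀ b k → b + 2 * k ≡ n → f k ≡ + g b k / 1) →
       foldr ℚ._+_ 0ℚ (applyUpTo f (suc ⌊ n /2⌋)) ≡ + Σ₂ n g / 1
  go zero          f g f≡g = trans (ℚ.+-identityʳ (f 0)) (f≡g 0 0 refl)
  go (suc zero)    f g f≡g = trans (ℚ.+-identityʳ (f 0)) (f≡g 1 0 refl)
  go (suc (suc n)) f g f≡g = trans
    (cong₂ ℚ._+_ (f≡g (2 + n) 0 (+-identityʳ (2 + n)))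
      (go n (λ k → f (suc k)) (λ b k → g b (suc k)) λ { b k refl → f≡g b (suc k) (step b k) }))
    (+-homo-/1 (g (2 + n) 0) _)
    where
    step : ∀ b k → b + 2 * suc k ≡ 2 + (b + 2 * k)
    step = solve-∀

-- Duplicate-free lists

length-≤ : {A : Set} {xs ys : List A} → Unique xs → (∀ {x} → x ∈ xs → x ∈ ys) → length xs ≤ length ys
length-≤ []        xs⊆ys = z≤n
length-≤ {A} {x ∷ xs} (x∉xs ∷ xs!) xs⊆ys with ∈-∃++ (xs⊆ys (here refl))
... | us , vs , refl = begin
  suc (length xs)             ≤⟨ s≤s (length-≤ xs! xs⊆us++vs) ⟩
  suc (length (us ++ vs))     ≡⟨ cong suc (length-++ us) ⟩
  suc (length us + length vs) ≡⟨ +-suc _ _ ⟨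
  length us + suc (length vs) ≡⟨ length-++ us ⟨
  length (us ++ x ∷ vs)       ∎
  where
  open ≤-Reasoning
  xs⊆us++vs : ∀ {y} → y ∈ xs → y ∈ us ++ vs
  xs⊆us++vs y∈xs with ∈-++⁻ us (xs⊆ys (there y∈xs))
  ... | inj₁ y∈us         = ∈-++⁺ˡ y∈us
  ... | inj₂ (here refl)  = contradiction refl (All.lookup x∉xs y∈xs)
  ... | inj₂ (there y∈vs) = ∈-++⁺ʳ us y∈vs

-- Pigeonhole: if `v` were missing, `v ∷ σ` would be duplicate-free and longer than the interval
-- m+1,...,n containing it.
unique∧full⇒∈ : ∀ {m n v σ} → Unique σ → All (λ x → m < x × x ≤ n) σ → m + length σ ≡ n →
                m < v → v ≤ n → v ∈ σ
unique∧full⇒∈ {m} {n} {v} {σ} σ! range refl m<v v≤n with _∈?_ _≟_ v σ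
... | yes v∈σ = v∈σ
... | no  v∉σ = contradiction
  (subst (suc (length σ) ≤_) (trans (length-map (λ d → suc m + d) (upTo (length σ))) (length-upTo (length σ)))
    (length-≤ (All.¬Any⇒All¬ _ v∉σ ∷ σ!) interval))
  1+n≰n
  where
  offset : ∀ {x} → m < x → x ≤ n → x ∈ map (λ d → suc m + d) (upTo (length σ))
  offset m<x x≤n = subst (_∈ _) (m+[n∸m]≡n m<x)
    (∈-map⁺ (λ d → suc m + d) (∈-upTo⁺ (+-cancelˡ-≤ m _ _
      (subst (_≤ n) (sym (trans (+-suc m _) (m+[n∸m]≡n m<x))) x≤n))))
  interval : ∀ {x} → x ∈ v ∷ σ → x ∈ map (λ d → suc m + d) (upTo (length σ))
  interval (here refl) = offset m<v v≤n
  interval (there x∈σ) = let m<x , x≤n = All.lookup range x∈σ in offset m<x x≤n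

-- Pattern avoidance

-- Used for `x` preceding `y`: labels may drop, but by at most one.
Near : ℕ → ℕ → Set
Near x y = x ≤ suc y

lookup-AllPairs : {A : Set} {R : A → A → Set} {xs : List A} → AllPairs R xs →
                  ∀ i j → i Fin.< j → R (lookup xs i) (lookup xs j)
lookup-AllPairs (x∼xs ∷ _)  zero    (suc j) _         = All.lookup x∼xs (∈-lookup j)
lookup-AllPairs (_ ∷ xs∼)   (suc i) (suc j) (s≤s i<j) = lookup-AllPairs xs∼ i j i<j

-- The value at `c` lies strictly between those at `a` and `b`, so an occurrence of `ρ` would make
-- `π` drop by at least two.
near⇒avoids : ∀ {π} ρ → AllPairs Near π → (a b c : Fin (length ρ)) →
              a Fin.< b → lookup ρ b < lookup ρ c → lookup ρ c < lookup ρ a → π Avoids ρ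
near⇒avoids {π} ρ near a b c a<b b<c c<a (i , mono , iso) =
  <-irrefl refl (≤-trans (s≤s (strict b c b<c)) (≤-trans (strict c a c<a)
    (lookup-AllPairs near _ _ (mono a b a<b))))
  where
  strict : ∀ a b → lookup ρ a < lookup ρ b →
           lookup π (Vec.lookup i a) < lookup π (Vec.lookup i b)
  strict a b a<b = ≰⇒> λ πb≤πa → <⇒≱ a<b (Equivalence.to (iso b a) πb≤πa)

step⇒mono : (f : ℕ → ℕ) → (∀ n → f n < f (suc n)) → ∀ {a b} → a < b → f a < f b
step⇒mono f step {a} {suc b} (s≤s a≤b) with m≤n⇒m<n∨m≡n a≤b
... | inj₁ a<b  = <-trans (step⇒mono f step a<b) (step b)
... | inj₂ refl = step b

-- A strictly increasing `f` preserves and reflects ≤, so one equation per letter replaces all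
-- pairwise comparisons.
occurrence : ∀ π ρ (f : ℕ → ℕ) → (∀ n → f n < f (suc n)) → ∀ i →
             (∀ a b → a Fin.< b → Vec.lookup i a Fin.< Vec.lookup i b) →
             (∀ a → lookup π (Vec.lookup i a) ≡ f (lookup ρ a)) → IsOccurrence π ρ i
occurrence π ρ f step i mono values = mono , λ a b → mk⇔
  (λ πa≤πb → ≮⇒≥ λ b<a → <⇒≱ (step⇒mono f step b<a) (subst₂ _≤_ (values a) (values b) πa≤πb))
  (λ a≤b → subst₂ _≤_ (sym (values a)) (sym (values b)) (weaken (m≤n⇒m<n∨m≡n a≤b)))
  where
  weaken : ∀ {a b} → a < b ⊎ a ≡ b → f a ≤ f b
  weaken (inj₁ a<b)  = <⇒≤ (step⇒mono f step a<b)
  weaken (inj₂ refl) = ≤-refl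

triple-mono : ∀ {l} {i j k : Fin l} → i Fin.< j → j Fin.< k →
              ∀ a b → a Fin.< b → Vec.lookup (i ∷ j ∷ k ∷ []) a Fin.< Vec.lookup (i ∷ j ∷ k ∷ []) b
triple-mono i<j j<k zero             (suc zero)       _ = i<j
triple-mono i<j j<k zero             (suc (suc zero)) _ = <-trans i<j j<k
triple-mono i<j j<k (suc zero)       (suc (suc zero)) _ = j<k
triple-mono i<j j<k (suc zero)       (suc zero) (s≤s ())
triple-mono i<j j<k (suc (suc zero)) (suc (suc zero)) (s≤s (s≤s ()))
triple-mono i<j j<k (suc (suc zero)) (suc zero) (s≤s ())

patterns : List (List ℕ)
patterns = (2 ∷ 3 ∷ 1 ∷ []) ∷ (3 ∷ 1 ∷ 2 ∷ []) ∷ (3 ∷ 2 ∷ 1 ∷ []) ∷ []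

-- The letters 1, 2, 3 become the values y, y + 1, x; the other clauses extend this to an increasing
-- map on ℕ, as `occurrence` asks.
rank : ℕ → ℕ → ℕ → ℕ
rank y x zero                = 0
rank y x (suc zero)          = y
rank y x (suc (suc zero))    = suc y
rank y x (suc (suc (suc r))) = r + x

rank-step : ∀ {y x} → 0 < y → suc y < x → ∀ r → rank y x r < rank y x (suc r)
rank-step 0<y gap zero                = 0<y
rank-step 0<y gap (suc zero)          = ≤-refl
rank-step 0<y gap (suc (suc zero))    = gap
rank-step 0<y gap (suc (suc (suc r))) = ≤-refl

-- If x precedes y in π and x > y + 1, then the position of the value y + 1
-- relative to those of x and y decides which of the three patterns occurs.
avoids⇒near : ∀ {n π} → IsPermutation n π → AvoidsAll patterns π → AllPairs Near π
avoids⇒near {n} {π} (length≡n , range , π!) (avoids₂₃₁ ∷ avoids₃₁₂ ∷ avoids₃₂₁ ∷ []) =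
  subst (AllPairs Near) (tabulate-lookup π) (AllPairs.tabulate⁺-< near)
  where
  near : ∀ {i j} → i Fin.< j → Near (lookup π i) (lookup π j)
  -- If `Near` fails, then y + 1 < x ≤ n, so the permutation attains the value y + 1.
  near {i} {j} i<j = ≮⇒≥ λ gap → locate gap
    (unique∧full⇒∈ π! range length≡n z<s
      (≤-trans (<⇒≤ gap) (proj₂ (All.lookup range (∈-lookup i)))))
    where
    locate : suc (lookup π j) < lookup π i → ¬ (suc (lookup π j) ∈ π)
    locate gap v∈π = split (Fin.<-cmp k i) (Fin.<-cmp k j)
      where
      k = Any.index v∈π
      v≡πk = lookup-index v∈π
      occurs : ∀ ρ i′ → (∀ a b → a Fin.< b → Vec.lookup i′ a Fin.< Vec.lookup i′ b) →
               (∀ a → lookup π (Vec.lookup i′ a) ≡ rank (lookup π j) (lookup π i) (lookup ρ a)) →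
               π Contains ρ
      occurs ρ i′ mono values = i′ , occurrence π ρ (rank (lookup π j) (lookup π i))
        (rank-step (proj₁ (All.lookup range (∈-lookup j))) gap) i′ mono values
      split : Tri (k Fin.< i) (k ≡ i) (i Fin.< k) → Tri (k Fin.< j) (k ≡ j) (j Fin.< k) → ⊥
      split (tri< k<i _ _) _ = avoids₂₃₁ (occurs (2 ∷ 3 ∷ 1 ∷ []) (k ∷ i ∷ j ∷ []) (triple-mono k<i i<j)
        λ { zero → sym v≡πk ; (suc zero) → refl ; (suc (suc zero)) → refl })
      split (tri≈ _ k≡i _) _ = <-irrefl (trans v≡πk (cong (lookup π) k≡i)) gap
      split (tri> _ _ i<k) (tri< k<j _ _) = avoids₃₂₁ (occurs (3 ∷ 2 ∷ 1 ∷ []) (i ∷ k ∷ j ∷ []) (triple-mono i<k k<j)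
        λ { zero → refl ; (suc zero) → sym v≡πk ; (suc (suc zero)) → refl })
      split (tri> _ _ _) (tri≈ _ k≡j _) = 1+n≢n (trans v≡πk (cong (lookup π) k≡j))
      split (tri> _ _ _) (tri> _ _ j<k) = avoids₃₁₂ (occurs (3 ∷ 1 ∷ 2 ∷ []) (i ∷ j ∷ k ∷ []) (triple-mono i<j j<k)
        λ { zero → refl ; (suc zero) → refl ; (suc (suc zero)) → sym v≡πk })

near⇒avoidsAll : ∀ {π} → AllPairs Near π → AvoidsAll patterns π
near⇒avoidsAll near =
  -- The positions passed are those of the letters 3, 1 and 2, in this order.
  near⇒avoids (2 ∷ 3 ∷ 1 ∷ []) near (suc zero) (suc (suc zero)) zero (s≤s (s≤s z≤n)) ≤-refl ≤-refl ∷
  near⇒avoids (3 ∷ 1 ∷ 2 ∷ []) near zero (suc zero) (suc (suc zero)) z<s ≤-refl ≤-refl ∷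
  near⇒avoids (3 ∷ 2 ∷ 1 ∷ []) near zero (suc (suc zero)) (suc zero) z<s ≤-refl ≤-refl ∷ []

-- Dyck paths and labels from an intermediate state

-- Paths from height h, after m north steps, to height 0, after n north steps.
data Dyck (n : ℕ) : (h m : ℕ) → List Step → Set where
  []  : Dyck n 0 n []
  N∷_ : ∀ {p} → Dyck n (suc h) (suc m) p → Dyck n h m (N ∷ p)
  E∷_ : ∀ {p} → Dyck n h m p → Dyck n (suc h) m (E ∷ p)

#N-dyck : ∀ {p} → Dyck n h m p → m + #N p ≡ n
#N-dyck []         = +-identityʳ _
#N-dyck (N∷ dyck)  = trans (+-suc _ _) (#N-dyck dyck)
#N-dyck (E∷ dyck)  = #N-dyck dyck

#E-dyck : ∀ {p} → Dyck n h m p → #E p ≡ h + #N p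
#E-dyck []         = refl
#E-dyck (N∷ dyck)  = trans (#E-dyck dyck) (sym (+-suc _ _))
#E-dyck (E∷ dyck)  = cong suc (#E-dyck dyck)

above-dyck : ∀ {p} → Dyck n h m p → All (λ q → #E q ≤ h + #N q) (inits p)
above-dyck []         = z≤n ∷ []
above-dyck (N∷ dyck)  = z≤n ∷ All.map⁺ (All.map (λ {q} → subst (#E q ≤_) (sym (+-suc _ _))) (above-dyck dyck))
above-dyck (E∷ dyck)  = z≤n ∷ All.map⁺ (All.map s≤s (above-dyck dyck))

dyck : ∀ p → m + #N p ≡ n → #E p ≡ h + #N p → All (λ q → #E q ≤ h + #N q) (inits p) → Dyck n h m p
dyck {m = m} {h = zero} [] refl _ _ = subst (λ n → Dyck n 0 m []) (sym (+-identityʳ m)) []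
dyck {h = suc h} []      _ () _
dyck             (N ∷ p) #N≡ #E≡ (_ ∷ above) = N∷ dyck p (trans (sym (+-suc _ _)) #N≡)
  (trans #E≡ (+-suc _ _)) (All.map (λ {q} → subst (#E q ≤_) (+-suc _ _)) (All.map⁻ above))
dyck {h = zero}  (E ∷ p) _ _ (_ ∷ () ∷ _)
dyck {h = suc h} (E ∷ p) #N≡ #E≡ (_ ∷ above) =
  E∷ dyck p #N≡ (suc-injective #E≡) (All.map ≤-pred (All.map⁻ above))

-- The invariant of the labels still to be read after 1,...,m. For m = 0 the fields other than
-- `near` amount to `IsPermutation n σ`.
record Labels (m n : ℕ) (σ : List ℕ) : Set where
  constructor labels
  field
    unique : Unique σ
    range  : All (λ x → m < x × x ≤ n) σ
    near   : AllPairs Near σ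
    full   : m + length σ ≡ n

labels-[] : Labels n n []
labels-[] = labels [] [] [] (+-identityʳ _)

labels-∷⁺ : ∀ {σ} → Labels (suc m) n σ → Labels m n (suc m ∷ σ)
labels-∷⁺ {m} {n} {σ} (labels σ! range near full) = labels
  (All.map (<⇒≢ ∘ proj₁) range ∷ σ!)
  ((≤-refl , subst (suc m ≤_) full (m≤m+n (suc m) _)) ∷ All.map (λ (m<x , x≤n) → <-trans ≤-refl m<x , x≤n) range)
  (All.map (λ (m<x , _) → ≤-trans (<⇒≤ m<x) (n≤1+n _)) range ∷ near)
  (trans (+-suc m _) full)

labels-∷∷⁺ : ∀ {σ} → Labels (2 + m) n σ → Labels m n (2 + m ∷ 1 + m ∷ σ)
labels-∷∷⁺ {m} {n} {σ} (labels σ! range near full) = labels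
  ((1+n≢n ∷ All.map (<⇒≢ ∘ proj₁) range) ∷ All.map (<⇒≢ ∘ <⇒≤ ∘ proj₁) range ∷ σ!)
  ((m<n⇒m<1+n ≤-refl , 2+m≤n) ∷ (≤-refl , <⇒≤ 2+m≤n) ∷
    All.map (λ (2+m<x , x≤n) → <-trans (m<n⇒m<1+n ≤-refl) 2+m<x , x≤n) range)
  ((≤-refl ∷ All.map (λ (2+m<x , _) → m≤n⇒m≤1+n (<⇒≤ 2+m<x)) range) ∷
    All.map (λ (2+m<x , _) → m≤n⇒m≤1+n (<⇒≤ (<⇒≤ 2+m<x))) range ∷ near)
  (trans (+-suc m _) (trans (cong suc (+-suc m _)) full))
  where
  2+m≤n : 2 + m ≤ n
  2+m≤n = subst (2 + m ≤_) full (m≤m+n (2 + m) _)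

range-suc : ∀ {σ} → All (suc m ≢_) σ → All (λ x → m < x × x ≤ n) σ → All (λ x → suc m < x × x ≤ n) σ
range-suc 1+m≢ range = All.zipWith (λ (1+m≢x , m<x , x≤n) → ≤∧≢⇒< m<x 1+m≢x , x≤n) (1+m≢ , range)

1+m∈ : ∀ {x σ} → Labels m n (x ∷ σ) → x ≢ suc m → suc m ∈ σ
1+m∈ (labels x∷σ! range@((m<x , x≤n) ∷ _) _ full) x≢1+m
  with unique∧full⇒∈ x∷σ! range full ≤-refl (≤-trans m<x x≤n)
... | here 1+m≡x  = contradiction (sym 1+m≡x) x≢1+m
... | there 1+m∈σ = 1+m∈σ

-- A label y between m + 2 and m + 1 would satisfy m < y ≤ m + 2 by `near`, hence repeat one of the
-- two.
labels-swap⁻ : ∀ {σ} → Labels m n (2 + m ∷ σ) → ∃[ σ′ ] σ ≡ suc m ∷ σ′ × Labels (2 + m) n σ′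
labels-swap⁻ ls with 1+m∈ ls 1+n≢n
labels-swap⁻ {m} (labels ((_ ∷ 2+m≢) ∷ 1+m≢ ∷ σ!) (_ ∷ _ ∷ range) (_ ∷ _ ∷ near) full) | here refl =
  _ , refl , labels σ! (range-suc 2+m≢ (range-suc 1+m≢ range)) near
    (trans (sym (trans (+-suc m _) (cong suc (+-suc m _)))) full)
labels-swap⁻ {m} (labels ((2+m≢y ∷ _) ∷ y≢ ∷ _) (_ ∷ (m<y , _) ∷ _) (_ ∷ y-near ∷ _) _) | there 1+m∈σ
  with m≤n⇒m<n∨m≡n m<y
... | inj₁ 1+m<y = contradiction (≤-antisym 1+m<y (All.lookup y-near 1+m∈σ)) 2+m≢y
... | inj₂ refl  = contradiction refl (All.lookup y≢ 1+m∈σ)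

-- This splits off the first block, 1 or 21: unless m + 1 comes first it comes later, and then
-- `near` gives x ≤ m + 2.
labels-∷⁻ : ∀ {x σ} → Labels m n (x ∷ σ) →
            (x ≡ suc m × Labels (suc m) n σ) ⊎
            (x ≡ 2 + m × ∃[ σ′ ] σ ≡ suc m ∷ σ′ × Labels (2 + m) n σ′)
labels-∷⁻ {m} {x = x} ls@(labels (x≢ ∷ σ!) ((m<x , _) ∷ range) (x-near ∷ near) full) with x ≟ suc m
... | yes refl = inj₁ (refl , labels σ! (range-suc x≢ range) near (trans (sym (+-suc m _)) full))
... | no x≢1+m with ≤-antisym (All.lookup x-near (1+m∈ ls x≢1+m)) (≤∧≢⇒< m<x (x≢1+m ∘ sym))
...   | refl = inj₂ (refl , labels-swap⁻ ls)

-- Building parking functions step by step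

-- Words are stored last step first.  Free h m w: w ends at height h and carries the
-- labels 1,…,m.  Pend h m w: it carries 1,…,m and m+2, with an east step after the latter.
data Free : (h m : ℕ) → List LabelledStep → Set
data Pend : (h m : ℕ) → List LabelledStep → Set

data Free where
  ε      : Free 0 0 []
  east   : ∀ {w} → Free (suc h) m w → Free h m (east ∷ w)
  single : ∀ {w} → Free h m w → Free (suc h) (suc m) (north (suc m) ∷ w)
  second : ∀ {w} → Pend h m w → Free (suc h) (2 + m) (north (suc m) ∷ w)

data Pend where
  -- The east step is built in because m + 1 may not directly follow the larger label m + 2.
  first : ∀ {w} → Free h m w → Pend h m (east ∷ north (2 + m) ∷ w)
  east  : ∀ {w} → Pend (suc h) m w → Pend h m (east ∷ w)

-- r completes a Free h m prefix to a parking function of size n.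
record Completion (n h m : ℕ) (r : List LabelledStep) : Set where
  constructor completion
  field
    dyckᶜ   : Dyck n h m (path r)
    labelsᶜ : Labels m n (φ r)
    linkedᶜ : Linked IncreasingNorths r

linked-east⁺ : ∀ {r} → Linked IncreasingNorths r → Linked IncreasingNorths (east ∷ r)
linked-east⁺ []             = [-]
linked-east⁺ [-]            = tt ∷ [-]
linked-east⁺ (s∼s′ ∷ linked) = tt ∷ s∼s′ ∷ linked

linked-north⁺ : ∀ {x r} → All (x <_) (φ r) → Linked IncreasingNorths r → Linked IncreasingNorths (north x ∷ r)
linked-north⁺ {r = []}          _         _      = [-]
linked-north⁺ {r = east ∷ _}    _         linked = tt ∷ linked
linked-north⁺ {r = north _ ∷ _} (x<y ∷ _) linked = x<y ∷ linked

-- Steps move one at a time from the end of `w` to the front of `r`, which stays a completion until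
-- it is the whole word.
free-sound : ∀ {w r} → Free h m w → Completion n h m r → Completion n 0 0 (w ʳ++ r)
-- A pending prefix has m + 1 north steps, hence `suc m` in `Dyck`, and the next label has to be m +
-- 1.
pend-sound : ∀ {w r σ} → Pend h m w → Dyck n h (suc m) (path r) → φ r ≡ suc m ∷ σ →
             Labels (2 + m) n σ → Linked IncreasingNorths r → Completion n 0 0 (w ʳ++ r)
free-sound ε           c = c
free-sound (east f)    (completion d l k) = free-sound f (completion (E∷ d) l (linked-east⁺ k))
free-sound (single f)  (completion d l k) = free-sound f
  (completion (N∷ d) (labels-∷⁺ l) (linked-north⁺ (All.map proj₁ (Labels.range l)) k))
free-sound (second f)  (completion d l k) = pend-sound f (N∷ d) refl l
  (linked-north⁺ (All.map (<⇒≤ ∘ proj₁) (Labels.range l)) k)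
pend-sound {m = m} (first f) d σ≡ l k = free-sound f
  (completion (N∷ E∷ d) (subst (λ σ → Labels m _ (2 + m ∷ σ)) (sym σ≡) (labels-∷∷⁺ l)) (tt ∷ linked-east⁺ k))
pend-sound (east f) d σ≡ l k = pend-sound f (E∷ d) σ≡ l (linked-east⁺ k)

-- The opposite traversal: `r` is parsed onto `w`, and `labels-∷⁻` tells whether a north step is a
-- block of its own or opens a block 21.
free-complete : ∀ {w} r → Free h m w → Completion n h m r → Free 0 n (r ʳ++ w)
pend-complete : ∀ {w} r {σ} → Pend h m w → Dyck n h (suc m) (path r) → φ r ≡ suc m ∷ σ →
                Labels (2 + m) n σ → Linked IncreasingNorths r → Free 0 n (r ʳ++ w)
free-complete []            f (completion [] _ _)          = f
free-complete (east ∷ r)    f (completion (E∷ d) l k)      = free-complete r (east f) (completion d l (Linked.tail k))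
free-complete (north x ∷ r) f (completion (N∷ d) l k) with labels-∷⁻ l
... | inj₁ (refl , l′) = free-complete r (single f) (completion d l′ (Linked.tail k))
free-complete (north x ∷ east ∷ r) f (completion (N∷ E∷ d) l k) | inj₂ (refl , _ , σ≡ , l′) =
  pend-complete r (first f) d σ≡ l′ (Linked.tail (Linked.tail k))
-- The labels m + 2, m + 1 on consecutive north steps violate `IncreasingNorths`.
free-complete (north x ∷ north y ∷ r) f (completion (N∷ d) l (x<y ∷ _)) | inj₂ (refl , _ , refl , _) =
  contradiction x<y (<-asym ≤-refl)
pend-complete (east ∷ r)    f (E∷ d) σ≡   l k = pend-complete r (east f) d σ≡ l (Linked.tail k)
pend-complete (north y ∷ r) f (N∷ d) refl l k = free-complete r (second f) (completion d l (Linked.tail k))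

-- Enumeration of the words

-- The words with e east steps in Free h (e + h), resp. with e + 1 east steps in
-- Pend h (e + h).
freeWords pendWords : (e h : ℕ) → List (List LabelledStep)
freeWords zero    zero    = [] ∷ []
-- Without east steps there is no block 21, so every label is a `single`.
freeWords zero    (suc h) = map (north (suc h) ∷_) (freeWords 0 h)
freeWords (suc e) zero    = map (east ∷_) (freeWords e 1)
freeWords (suc e) (suc h) = map (east ∷_) (freeWords e (2 + h)) ++
  map (north (2 + e + h) ∷_) (freeWords (suc e) h) ++ map (north (suc (e + h)) ∷_) (pendWords e h)
pendWords zero    h = map (λ w → east ∷ north (2 + h) ∷ w) (freeWords 0 h)
pendWords (suc e) h = map (east ∷_) (pendWords e (suc h)) ++
  map (λ w → east ∷ north (3 + e + h) ∷ w) (freeWords (suc e) h)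

-- By last step, T μʰ⁺¹ = T μʰ⁺² + x T μʰ + x (x T² μʰ), for east, `single` and `second`. After
-- removal of the factor x, pending words give T² μʰ = T² μʰ⁺¹ + T μʰ, for `east` and `first`. Both
-- are instances of `coeffμ-step`.
length-freeWords : ∀ e h → length (freeWords e h) ≡ coeffμ e 1 h
length-pendWords : ∀ e h → length (pendWords e h) ≡ coeffμ e 2 h
length-freeWords zero    zero    = refl
length-freeWords zero    (suc h) = trans (length-map _ (freeWords 0 h))
  (trans (length-freeWords 0 h) (sym (coeffμ-zero 1 h)))
length-freeWords (suc e) zero    = trans (length-map _ (freeWords e 1))
  (trans (length-freeWords e 1) (sym (coeffμ-step e 0 0)))
length-freeWords (suc e) (suc h) = begin
  length (freeWords (suc e) (suc h))
    ≡⟨ trans (length-++ (map (east ∷_) (freeWords e (2 + h))))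
         (cong₂ _+_ (length-map _ (freeWords e (2 + h)))
           (trans (length-++ (map (north (2 + e + h) ∷_) (freeWords (suc e) h)))
             (cong₂ _+_ (length-map _ (freeWords (suc e) h)) (length-map _ (pendWords e h))))) ⟩
  length (freeWords e (2 + h)) + (length (freeWords (suc e) h) + length (pendWords e h))
    ≡⟨ cong₂ _+_ (length-freeWords e (2 + h)) (cong₂ _+_ (length-freeWords (suc e) h) (length-pendWords e h)) ⟩
  coeffμ e 1 (2 + h) + (coeffμ (suc e) 1 h + coeffμ e 2 h) ≡⟨ +-comm (coeffμ e 1 (2 + h)) _ ⟩
  coeffμ (suc e) 1 h + coeffμ e 2 h + coeffμ e 1 (2 + h)   ≡⟨ coeffμ-step e 0 (suc h) ⟨
  coeffμ (suc e) 1 (suc h) ∎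
  where open ≡-Reasoning
length-pendWords zero    h = trans (length-map _ (freeWords 0 h))
  (trans (length-freeWords 0 h) (sym (coeffμ-zero 1 h)))
length-pendWords (suc e) h = begin
  length (pendWords (suc e) h)
    ≡⟨ trans (length-++ (map (east ∷_) (pendWords e (suc h))))
         (cong₂ _+_ (length-map _ (pendWords e (suc h))) (length-map _ (freeWords (suc e) h))) ⟩
  length (pendWords e (suc h)) + length (freeWords (suc e) h)
    ≡⟨ cong₂ _+_ (length-pendWords e (suc h)) (length-freeWords (suc e) h) ⟩
  coeffμ e 2 (suc h) + coeffμ (suc e) 1 h ≡⟨ +-comm (coeffμ e 2 (suc h)) _ ⟩
  coeffμ (suc e) 1 h + coeffμ e 2 (suc h) ≡⟨ coeffμ-step e 1 h ⟨
  coeffμ (suc e) 2 h ∎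
  where open ≡-Reasoning

∈-freeWords⁺ : ∀ {w} → Free h m w → ∃[ e ] e + h ≡ m × w ∈ freeWords e h
∈-pendWords⁺ : ∀ {w} → Pend h m w → ∃[ e ] e + h ≡ m × w ∈ pendWords e h
∈-freeWords⁺ ε = 0 , refl , here refl
∈-freeWords⁺ {zero} (east f) with ∈-freeWords⁺ f
... | e , refl , w∈ = suc e , sym (+-suc e 0) , ∈-map⁺ (east ∷_) w∈
∈-freeWords⁺ {suc h} (east f) with ∈-freeWords⁺ f
... | e , refl , w∈ = suc e , sym (+-suc e (suc h)) , ∈-++⁺ˡ (∈-map⁺ (east ∷_) w∈)
∈-freeWords⁺ {suc h} (single f) with ∈-freeWords⁺ f
... | zero  , refl , w∈ = 0 , refl , ∈-map⁺ (north (suc h) ∷_) w∈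
... | suc e , refl , w∈ = suc e , +-suc (suc e) h ,
  ∈-++⁺ʳ (map (east ∷_) (freeWords e (2 + h))) (∈-++⁺ˡ (∈-map⁺ (north (2 + e + h) ∷_) w∈))
∈-freeWords⁺ {suc h} (second f) with ∈-pendWords⁺ f
... | e , refl , w∈ = suc e , +-suc (suc e) h ,
  ∈-++⁺ʳ (map (east ∷_) (freeWords e (2 + h)))
    (∈-++⁺ʳ (map (north (2 + e + h) ∷_) (freeWords (suc e) h)) (∈-map⁺ (north (suc (e + h)) ∷_) w∈))
∈-pendWords⁺ {h} (first f) with ∈-freeWords⁺ f
... | zero  , refl , w∈ = 0 , refl , ∈-map⁺ (λ w → east ∷ north (2 + h) ∷ w) w∈
... | suc e , refl , w∈ = suc e , refl ,
  ∈-++⁺ʳ (map (east ∷_) (pendWords e (suc h))) (∈-map⁺ (λ w → east ∷ north (3 + e + h) ∷ w) w∈)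
∈-pendWords⁺ {h} (east f) with ∈-pendWords⁺ f
... | e , refl , w∈ = suc e , sym (+-suc e h) , ∈-++⁺ˡ (∈-map⁺ (east ∷_) w∈)

∈-freeWords⁻ : ∀ e h {w} → w ∈ freeWords e h → Free h (e + h) w
∈-pendWords⁻ : ∀ e h {w} → w ∈ pendWords e h → Pend h (e + h) w
∈-freeWords⁻ zero zero (here refl) = ε
∈-freeWords⁻ zero (suc h) w∈ with ∈-map⁻ _ w∈
... | _ , v∈ , refl = single (∈-freeWords⁻ 0 h v∈)
∈-freeWords⁻ (suc e) zero w∈ with ∈-map⁻ _ w∈
... | v , v∈ , refl = east (subst (λ m → Free 1 m v) (+-suc e 0) (∈-freeWords⁻ e 1 v∈))
∈-freeWords⁻ (suc e) (suc h) w∈ with ∈-++⁻ (map (east ∷_) (freeWords e (2 + h))) w∈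
... | inj₁ u∈ with ∈-map⁻ _ u∈
...   | v , v∈ , refl = east (subst (λ m → Free (2 + h) m v) (+-suc e (suc h)) (∈-freeWords⁻ e (2 + h) v∈))
∈-freeWords⁻ (suc e) (suc h) _ | inj₂ w∈
  with ∈-++⁻ (map (north (2 + e + h) ∷_) (freeWords (suc e) h)) w∈
... | inj₁ u∈ with ∈-map⁻ _ u∈
...   | v , v∈ , refl =
  subst (λ m → Free (suc h) m (north (2 + e + h) ∷ v)) (sym (+-suc (suc e) h)) (single (∈-freeWords⁻ (suc e) h v∈))
∈-freeWords⁻ (suc e) (suc h) _ | inj₂ _ | inj₂ w∈ with ∈-map⁻ _ w∈
...   | v , v∈ , refl =
  subst (λ m → Free (suc h) m (north (suc (e + h)) ∷ v)) (sym (+-suc (suc e) h)) (second (∈-pendWords⁻ e h v∈))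
∈-pendWords⁻ zero h w∈ with ∈-map⁻ _ w∈
... | _ , v∈ , refl = first (∈-freeWords⁻ 0 h v∈)
∈-pendWords⁻ (suc e) h w∈ with ∈-++⁻ (map (east ∷_) (pendWords e (suc h))) w∈
... | inj₁ u∈ with ∈-map⁻ _ u∈
...   | v , v∈ , refl = east (subst (λ m → Pend (suc h) m v) (+-suc e h) (∈-pendWords⁻ e (suc h) v∈))
∈-pendWords⁻ (suc e) h _ | inj₂ w∈ with ∈-map⁻ _ w∈
... | _ , v∈ , refl = first (∈-freeWords⁻ (suc e) h v∈)

-- Absence of repetitions and the final count

map-disjoint : {A B : Set} {f g : A → B} {us vs : List A} → (∀ {u v} → u ∈ us → v ∈ vs → f u ≢ g v) →
               Disjoint (map f us) (map g vs)
map-disjoint f≢g (y∈fus , y∈gvs) with ∈-map⁻ _ y∈fus | ∈-map⁻ _ y∈gvs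
... | _ , u∈us , refl | _ , v∈vs , fu≡gv = f≢g u∈us v∈vs fu≡gv

++-disjoint : {A : Set} {us vs ws : List A} → Disjoint us vs → Disjoint us ws → Disjoint us (vs ++ ws)
++-disjoint {vs = vs} us#vs us#ws (y∈us , y∈vs++ws) with ∈-++⁻ vs y∈vs++ws
... | inj₁ y∈vs = us#vs (y∈us , y∈vs)
... | inj₂ y∈ws = us#ws (y∈us , y∈ws)

-- The alternatives differ in their last step: east, or north with label e + h + 2, or north with
-- label e + h + 1.
freeWords-unique : ∀ e h → Unique (freeWords e h)
pendWords-unique : ∀ e h → Unique (pendWords e h)
freeWords-unique zero    zero    = [] ∷ []
freeWords-unique zero    (suc h) = Unique.map⁺ ∷-injectiveʳ (freeWords-unique 0 h)
freeWords-unique (suc e) zero    = Unique.map⁺ ∷-injectiveʳ (freeWords-unique e 1)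
freeWords-unique (suc e) (suc h) = Unique.++⁺ (Unique.map⁺ ∷-injectiveʳ (freeWords-unique e (2 + h)))
  (Unique.++⁺ (Unique.map⁺ ∷-injectiveʳ (freeWords-unique (suc e) h))
    (Unique.map⁺ ∷-injectiveʳ (pendWords-unique e h))
    (map-disjoint λ _ _ eq → 1+n≢n (north-injective (proj₁ (∷-injective eq)))))
  (++-disjoint {vs = map (north (2 + e + h) ∷_) (freeWords (suc e) h)}
    (map-disjoint λ _ _ ()) (map-disjoint λ _ _ ()))
  where
  north-injective : ∀ {k l} → north k ≡ north l → k ≡ l
  north-injective refl = refl
pendWords-unique zero    h = Unique.map⁺ (∷-injectiveʳ ∘ ∷-injectiveʳ) (freeWords-unique 0 h)
pendWords-unique (suc e) h = Unique.++⁺ (Unique.map⁺ ∷-injectiveʳ (pendWords-unique e (suc h)))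
  (Unique.map⁺ (∷-injectiveʳ ∘ ∷-injectiveʳ) (freeWords-unique (suc e) h))
  -- Both kinds of pending word end in east; the step before it is east for one and north for the
  -- other.
  (map-disjoint λ u∈ _ eq → ends-east (∈-pendWords⁻ e (suc h) u∈) (∷-injectiveʳ eq))
  where
  ends-east : ∀ {h m u x w} → Pend h m u → u ≢ north x ∷ w
  ends-east (first _) ()
  ends-east (east _)  ()

length-filter≡ : {A : Set} {P : A → Set} (P? : U.Decidable P) {xs ys : List A} → Unique xs → Unique ys →
                 (∀ {x} → x ∈ xs → P x → x ∈ ys) → (∀ {x} → x ∈ ys → x ∈ xs × P x) →
                 length (filter P? xs) ≡ length ys
length-filter≡ P? {xs} xs! ys! to from = ≤-antisym
  (length-≤ (Unique.filter⁺ P? xs!) λ x∈ → let x∈xs , px = ∈-filter⁻ P? {xs = xs} x∈ in to x∈xs px)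
  (length-≤ ys! λ x∈ys → let x∈xs , px = from x∈ys in ∈-filter⁺ P? x∈xs px)

parking⇒∈words : ∀ {n p} → IsParkingFunction n p → AvoidsAll patterns (φ p) → p ∈ map reverse (freeWords n 0)
parking⇒∈words {n} {p} ((#N≡n , #E≡n , above) , perm@(length≡n , range , π!) , linked) avoids
  with ∈-freeWords⁺ (free-complete p ε (completion (dyck (path p) #N≡n (trans #E≡n (sym #N≡n)) above)
         (labels π! range (avoids⇒near perm avoids) length≡n) linked))
... | e , e+0≡n , w∈ = subst (_∈ _) (reverse-involutive p) (∈-map⁺ reverse
  (subst (λ e → reverse p ∈ freeWords e 0) (trans (sym (+-identityʳ e)) e+0≡n) w∈))

∈words⇒parking : ∀ {n p} → p ∈ map reverse (freeWords n 0) → IsParkingFunction n p × AvoidsAll patterns (φ p)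
∈words⇒parking {n} p∈ with ∈-map⁻ reverse p∈
... | w , w∈ , refl
  with free-sound (subst (λ m → Free 0 m w) (+-identityʳ n) (∈-freeWords⁻ n 0 w∈)) (completion [] labels-[] [])
... | completion d (labels π! range near full) linked =
  ((#N-dyck d , trans (#E-dyck d) (#N-dyck d) , above-dyck d) , (full , range , π!) , linked) ,
  near⇒avoidsAll near

pf≡coeffμ : ∀ n → pf n patterns ≡ coeffμ n 1 0
pf≡coeffμ n = trans
  (length-filter≡ {P = AvoidsAll patterns ∘ φ} (avoidsAll? patterns ∘ φ) (parkingFunctions-unique n)
    (Unique.map⁺ reverse-injective (freeWords-unique n 0))
    (λ {p} p∈ → parking⇒∈words (Equivalence.to (∈-parkingFunctions n p) p∈))
    (λ {p} p∈ → let parking , avoids = ∈words⇒parking p∈ in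
      Equivalence.from (∈-parkingFunctions n p) parking , avoids))
  (trans (length-map reverse (freeWords n 0)) (length-freeWords n 0))

theorem17 : (n : ℕ) → n ≥ 1 →
    + pf n ((2 ∷ 3 ∷ 1 ∷ []) ∷ (3 ∷ 1 ∷ 2 ∷ []) ∷ (3 ∷ 2 ∷ 1 ∷ []) ∷ []) / 1
    ≡ ∑[0⋯ ⌊ n /2⌋ ] (λ k →
    (+ 1 / suc n) ℚ.* (+ ((2 * n ∸ k) C (n + k)) / 1) ℚ.* (+ ((n + k) C k) / 1))
theorem17 n _ = trans
  (cong (λ count → + count / 1) (trans (pf≡coeffμ n) (coeff≡Σ₂τ n 1)))
  (sym (∑-Σ₂ n _ (τ 1) λ b k b+2k≡n →
    quotient n ((2 * n ∸ k) C (n + k)) ((n + k) C k) (τ 1 b k) (τ-binomial n b k b+2k≡n)))
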